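{- Let $M$ be a countable transitive model of $\mathsf{ZF}^-$ and suppose that there exists a global well-order (a well-order of $M$) of order type $\mathrm{Ord}^M$ that is definable over $M$. Then there is a notion of class forcing $\mathbb{P}$ (a partial order definable over $M$) which has two Boolean completions in $M$ that are non-isomorphic, in the sense that there is no isomorphism in $\mathsf{V}$ between them which fixes $\mathbb{P}$.
   Context: We work in a model $\mathsf{V}$ of $\mathsf{ZFC}$. $\mathsf{ZF}^-$ denotes the axioms of $\mathsf{ZF}$ without the power set axiom and with Collection instead of Replacement. $\mathrm{Ord}^M$ is the class of ordinals of $M$. "Definable over $M$" means first-order definable over $\langle M,\in\rangle$, parameters from $M$ being allowed; a partial order is definable over $M$ if both its domain (a subset of $M$) and its order relation are. A Boolean algebra $\mathbb{B}$ is definable over $M$ if its domain and all its Boolean operations are definable over $M$; such a $\mathbb{B}$ is $M$-complete if $\sup_{\mathbb{B}}A$ exists in $\mathbb{B}$ for every $A\subseteq\mathbb{B}$ with $A\in M$. A Boolean completion of $\mathbb{P}$ in $M$ is an $M$-complete Boolean algebra $\mathbb{B}$ together with an injective dense embedding $\pi$ of $\mathbb{P}$ into $\mathbb{B}\setminus\{0_{\mathbb{B}}\}$ (an injective map with $p\leq q\Leftrightarrow\pi(p)\leq\pi(q)$ whose range is dense in $\mathbb{B}\setminus\{0_{\mathbb{B}}\}$) such that both $\mathbb{B}$ and $\pi$ are definable over $M$. An isomorphism $f:\mathbb{B}_0\to\mathbb{B}_1$ between Boolean completions with embeddings $\pi_0,\pi_1$ fixes $\mathbb{P}$ if $f(\pi_0(p))=\pi_1(p)$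 for all $p\in\mathbb{P}$. -}

module Defs where

open import Algebra.Core using (Op₁; Op₂)
open import Algebra.Lattice.Bundles using (BooleanAlgebra)
open import Algebra.Lattice.Morphism.Structures using (IsLatticeIsomorphism)
import Algebra.Lattice.Properties.Lattice as LatticeProperties
open import Algebra.Lattice.Structures using (IsBooleanAlgebra)
open import Algebra.Morphism.Definitions using (Homomorphic₀; Homomorphic₁)
open import Data.Empty using (⊥)
open import Data.Fin using (Fin)
open import Data.Nat using (ℕ; suc; _+_)
open import Data.Product using (Σ; ∃; ∃₂; ∃-syntax; _×_; proj₁)
open import Data.Sum using (_⊎_)
open import Data.Vec using (Vec; []; _∷_; _++_; lookup)
open import Data.Vec.N-ary using (N-ary; _$ⁿ_)
open import Function using (_on_; _⇔_; Congruent; Injective)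
open import Induction.WellFounded using (WellFounded)
open import Level using (0ℓ)
open import Relation.Binary.Bundles using (module Poset)
open import Relation.Binary.Core using (Rel)
open import Relation.Binary.Morphism.Structures
  using (IsOrderMonomorphism; IsOrderIsomorphism)
open import Relation.Binary.PropositionalEquality using (_≡_)
open import Relation.Binary.Structures using (IsPartialOrder; IsStrictTotalOrder)
open import Relation.Nullary using (¬_)
open import Relation.Unary using (Pred)

infix 4 _≈_ _∈_ _∈ᶠ_ _≈ᶠ_

-- The set-theoretic universe: Aczel's iterative sets, with bisimilarity as
-- equality.  A set is a family of sets indexed by a type.
data V : Set₁ where
  sup : (A : Set) → (A → V) → V

_≈_ : V → V → Set
sup A f ≈ sup B g =
  (∀ a → ∃[ b ] f a ≈ g b) × (∀ b → ∃[ a ] f a ≈ g b)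

-- The elements of a set are represented by its indices; x ⟨ i ⟩ is the set that
-- i stands for.  Two indices denote the same element when their values are
-- bisimilar, so El x is always used with the equality Eq x below, never _≡_.
El : V → Set
El (sup A f) = A

_⟨_⟩ : (x : V) → El x → V
sup A f ⟨ i ⟩ = f i

_∈_ : V → V → Set
x ∈ y = Σ (El y) λ i → x ≈ (y ⟨ i ⟩)

Eq : (x : V) → Rel (El x) 0ℓ
Eq x = _≈_ on (x ⟨_⟩)

Mem : (x : V) → Rel (El x) 0ℓ
Mem x = _∈_ on (x ⟨_⟩)

Transitive : V → Set₁
Transitive x = ∀ {y z} → y ∈ x → z ∈ y → z ∈ x

Countable : V → Set
Countable x =
  ∃[ f ] Congruent (Eq x) (_≡_ {A = ℕ}) f × Injective (Eq x) _≡_ f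

record IsWellOrder {A : Set} (_≈ₐ_ _<_ : Rel A 0ℓ) : Set where
  field
    isStrictTotalOrder : IsStrictTotalOrder _≈ₐ_ _<_
    wellFounded        : WellFounded _<_

IsOrdinal : V → Set₁
IsOrdinal x = Transitive x × IsWellOrder (Eq x) (Mem x)

-- Formulas of the language {∈, =}; variables are de Bruijn indices.
data Formula (n : ℕ) : Set where
  _∈ᶠ_ _≈ᶠ_      : Fin n → Fin n → Formula n
  ⊥ᶠ             : Formula n
  _∧ᶠ_ _∨ᶠ_ _⇒ᶠ_ : Formula n → Formula n → Formula n
  ∀ᶠ ∃ᶠ          : Formula (suc n) → Formula n

module _ (M : V) where

  infix 4 _≈ᴹ_ _∈ᴹ_

  _≈ᴹ_ _∈ᴹ_ : Rel (El M) 0ℓ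
  _≈ᴹ_ = Eq M
  _∈ᴹ_ = Mem M

  Sat : ∀ {n} → Formula n → Vec (El M) n → Set
  Sat (i ∈ᶠ j) ρ = lookup ρ i ∈ᴹ lookup ρ j
  Sat (i ≈ᶠ j) ρ = lookup ρ i ≈ᴹ lookup ρ j
  Sat ⊥ᶠ       ρ = ⊥
  Sat (φ ∧ᶠ ψ) ρ = Sat φ ρ × Sat ψ ρ
  Sat (φ ∨ᶠ ψ) ρ = Sat φ ρ ⊎ Sat ψ ρ
  Sat (φ ⇒ᶠ ψ) ρ = Sat φ ρ → Sat ψ ρ
  Sat (∀ᶠ φ)   ρ = ∀ x → Sat φ (x ∷ ρ)
  Sat (∃ᶠ φ)   ρ = ∃[ x ] Sat φ (x ∷ ρ)

  -- ⟨M, ∈⟩ ⊨ ZF⁻.  The axioms are written as their satisfaction clauses in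
  -- ⟨M, ∈⟩: all quantifiers range over elements of M, and the two schemes range
  -- over all formulas φ with parameters p from M.
  record ModelOfZF⁻ : Set where
    field
      extensionality : ∀ x y → (∀ z → z ∈ᴹ x ⇔ z ∈ᴹ y) → x ≈ᴹ y
      foundation     : ∀ x → (∃[ y ] y ∈ᴹ x) →
                       ∃[ y ] y ∈ᴹ x × (∀ z → z ∈ᴹ x → ¬ z ∈ᴹ y)
      pairing        : ∀ x y → ∃[ w ] ∀ z → z ∈ᴹ w ⇔ (z ≈ᴹ x ⊎ z ≈ᴹ y)
      union          : ∀ x → ∃[ w ] ∀ z → z ∈ᴹ w ⇔ (∃[ y ] y ∈ᴹ x × z ∈ᴹ y)
      infinity       : ∃[ w ] (∃[ e ] e ∈ᴹ w × (∀ z → ¬ z ∈ᴹ e)) ×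
                       (∀ x → x ∈ᴹ w →
                         ∃[ y ] y ∈ᴹ w × (∀ z → z ∈ᴹ y ⇔ (z ∈ᴹ x ⊎ z ≈ᴹ x)))
      separation     : ∀ {n} (φ : Formula (1 + n)) (p : Vec (El M) n) x →
                       ∃[ w ] ∀ z → z ∈ᴹ w ⇔ (z ∈ᴹ x × Sat φ (z ∷ p))
      collection     : ∀ {n} (φ : Formula (2 + n)) (p : Vec (El M) n) a →
                       (∀ x → x ∈ᴹ a → ∃[ y ] Sat φ (x ∷ y ∷ p)) →
                       ∃[ b ] ∀ x → x ∈ᴹ a → ∃[ y ] y ∈ᴹ b × Sat φ (x ∷ y ∷ p)

  -- A k-ary relation on M is definable over ⟨M, ∈⟩ with parameters.
  Definable : ∀ k → N-ary k (El M) Set → Set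
  Definable k R =
    ∃[ n ] Σ (Formula (k + n)) λ φ → Σ (Vec (El M) n) λ p →
      ∀ (v : Vec (El M) k) → (R $ⁿ v) ⇔ Sat φ (v ++ p)

  -- For transitive M this is Ord ∩ M.
  OrdinalsOf : Set₁
  OrdinalsOf = Σ (El M) λ i → IsOrdinal (M ⟨ i ⟩)

  record DefinableGlobalWellOrder : Set₁ where
    field
      _≺_         : Rel (El M) 0ℓ
      definable   : Definable 2 _≺_
      isWellOrder : IsWellOrder _≈ᴹ_ _≺_
      -- The isomorphism witnessing order type Ord^M lives in V; it is not
      -- required to be definable over M.
      enumeration : El M → OrdinalsOf
      orderType   : IsOrderIsomorphism _≈ᴹ_ (_≈ᴹ_ on proj₁)
                      _≺_ (_∈ᴹ_ on proj₁) enumeration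

  -- A class of M is a predicate D on El M.  Its members carry a proof of
  -- membership, which equality ignores.
  Members : Pred (El M) 0ℓ → Set
  Members D = Σ (El M) D

  EqOn : (D : Pred (El M) 0ℓ) → Rel (Members D) 0ℓ
  EqOn D = _≈ᴹ_ on proj₁

  -- Relations and functions between classes, viewed as relations on M.
  module _ {D : Pred (El M) 0ℓ} where

    Extension : Rel (Members D) 0ℓ → N-ary 2 (El M) Set
    Extension R x y = ∃₂ λ a b → x ≈ᴹ proj₁ a × y ≈ᴹ proj₁ b × R a b

    Graph₁ : {E : Pred (El M) 0ℓ} → (Members D → Members E) → N-ary 2 (El M) Set
    Graph₁ f x y = ∃ λ a → x ≈ᴹ proj₁ a × y ≈ᴹ proj₁ (f a)

    Graph₂ : Op₂ (Members D) → N-ary 3 (El M) Set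
    Graph₂ _∙_ x y z =
      ∃₂ λ a b → x ≈ᴹ proj₁ a × y ≈ᴹ proj₁ b × z ≈ᴹ proj₁ (a ∙ b)

  record ClassForcing : Set₁ where
    field
      Dom            : Pred (El M) 0ℓ
      _≤_            : Rel (Members Dom) 0ℓ
      isPartialOrder : IsPartialOrder (EqOn Dom) _≤_
      Dom-definable  : Definable 1 Dom
      ≤-definable    : Definable 2 (Extension _≤_)

  record DefinableBooleanAlgebra : Set₁ where
    field
      Dom              : Pred (El M) 0ℓ
      _∨_ _∧_          : Op₂ (Members Dom)
      ∁                : Op₁ (Members Dom)
      𝟙 𝟘              : Members Dom
      isBooleanAlgebra : IsBooleanAlgebra (EqOn Dom) _∨_ _∧_ ∁ 𝟙 𝟘
      Dom-definable    : Definable 1 Dom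
      ∨-definable      : Definable 3 (Graph₂ _∨_)
      ∧-definable      : Definable 3 (Graph₂ _∧_)
      ∁-definable      : Definable 2 (Graph₁ ∁)
      𝟙-definable      : Definable 1 (λ x → x ≈ᴹ proj₁ 𝟙)
      𝟘-definable      : Definable 1 (λ x → x ≈ᴹ proj₁ 𝟘)

    booleanAlgebra : BooleanAlgebra 0ℓ 0ℓ
    booleanAlgebra = record { isBooleanAlgebra = isBooleanAlgebra }

    open BooleanAlgebra booleanAlgebra public using (lattice; rawLattice)

    -- The induced order of the lattice: a ≤ b means a = a ∧ b.
    open Poset (LatticeProperties.poset lattice) public using (_≤_)

    IsSupremum : Pred (Members Dom) 0ℓ → Members Dom → Set
    IsSupremum A s =
      (∀ a → A a → a ≤ s) × (∀ u → (∀ a → A a → a ≤ u) → s ≤ u)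

    -- Suprema are required only for those subsets of the algebra that are
    -- elements of M.
    M-complete : Set
    M-complete = ∀ (A : El M) → (∀ x → x ∈ᴹ A → Dom x) →
                 ∃[ s ] IsSupremum (λ b → proj₁ b ∈ᴹ A) s

  record BooleanCompletion (ℙ : ClassForcing) : Set₁ where
    private module ℙ = ClassForcing ℙ
    field
      algebra : DefinableBooleanAlgebra
    open DefinableBooleanAlgebra algebra public
    field
      complete    : M-complete
      π           : Members ℙ.Dom → Members Dom
      π-nonzero   : ∀ p → ¬ EqOn Dom (π p) 𝟘
      π-embedding : IsOrderMonomorphism (EqOn ℙ.Dom) (EqOn Dom) ℙ._≤_ _≤_ π
      π-dense     : ∀ b → ¬ EqOn Dom b 𝟘 → ∃[ p ] π p ≤ b
      π-definable : Definable 2 (Graph₁ π)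

  record IsomorphismFixing {ℙ : ClassForcing} (𝔹₀ 𝔹₁ : BooleanCompletion ℙ) : Set where
    private
      module ℙ  = ClassForcing ℙ
      module 𝔹₀ = BooleanCompletion 𝔹₀
      module 𝔹₁ = BooleanCompletion 𝔹₁
      A   = Members 𝔹₀.Dom
      B   = Members 𝔹₁.Dom
      _≃_ = EqOn 𝔹₁.Dom
    field
      f            : A → B
      isomorphism  : IsLatticeIsomorphism 𝔹₀.rawLattice 𝔹₁.rawLattice f
      ∁-homo       : Homomorphic₁ A B _≃_ f 𝔹₀.∁ 𝔹₁.∁
      𝟙-homo       : Homomorphic₀ A B _≃_ f 𝔹₀.𝟙 𝔹₁.𝟙
      𝟘-homo       : Homomorphic₀ A B _≃_ f 𝔹₀.𝟘 𝔹₁.𝟘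
      fixes        : ∀ p → f (𝔹₀.π p) ≃ 𝔹₁.π p

{-# OPTIONS --safe #-}

-- Take for ℙ a proper class with the discrete order, split into two definable
-- proper classes.  The sets and their complements form a Boolean completion, and
-- so do the classes that differ by a set from ∅, ℙ or one of the two parts.  An
-- isomorphism fixing ℙ preserves which conditions lie below an element, but an
-- element of the first algebra cannot agree up to a set with one of the parts.

module Submission where

open import Defs
open import Algebra.Core using (Op₂)
open import Algebra.Lattice.Bundles using (RawLattice)
open import Algebra.Lattice.Morphism.LatticeMonomorphism using (isDistributiveLattice)
open import Algebra.Lattice.Morphism.Structures
  using (IsLatticeMonomorphism; IsLatticeIsomorphism)
open import Algebra.Lattice.Structures using (IsDistributiveLattice; IsBooleanAlgebra)
open import Axiom.ExcludedMiddle using (ExcludedMiddle)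
open import Data.Bool.Base using (Bool; true; false; not; _∧_; _∨_; _xor_; if_then_else_)
open import Data.Bool.Properties
  using ( xor-assoc; xor-same; xor-identityʳ; ∨-identityʳ; ∧-zeroʳ; ∧-conicalˡ
        ; ∨-comm; ∨-assoc; ∧-comm; ∧-assoc; ∨-abs-∧; ∧-abs-∨
        ; ∨-distribˡ-∧; ∨-distribʳ-∧; ∧-distribˡ-∨; ∧-distribʳ-∨
        ; ∨-inverseˡ; ∨-inverseʳ; ∧-inverseˡ; ∧-inverseʳ )
open import Data.Fin using (Fin)
open import Data.Fin.Patterns using (0F; 1F; 2F; 3F; 4F; 5F)
open import Data.Nat using (_+_)
open import Data.Product using (Σ; ∃₂; ∃-syntax; _×_; _,_; proj₁; proj₂)
open import Data.Sum using (_⊎_; inj₁; inj₂; [_,_]′)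
open import Data.Vec using (Vec; []; _∷_; lookup)
open import Function using (_∘′_; _on_; _⇔_; mk⇔; Equivalence)
open import Level using (0ℓ)
open import Relation.Binary.Core using (Rel)
open import Relation.Binary.PropositionalEquality
  using (_≡_; refl; sym; trans; cong; cong₂; module ≡-Reasoning)
open import Relation.Nullary using (¬_; Dec; does; proof; contradiction; yes; no)
open import Relation.Nullary.Reflects
  using (Reflects; ofʸ; ofⁿ; det; ¬-reflects; _×-reflects_; _⊎-reflects_)
open import Relation.Unary using (Pred)

open Equivalence using (to; from)

-- Bisimilarity and membership.

≈-refl : ∀ {x} → x ≈ x
≈-refl {sup A f} = (λ a → a , ≈-refl) , (λ a → a , ≈-refl)

≈-sym : ∀ {x y} → x ≈ y → y ≈ x
≈-sym {sup A f} {sup B g} (p , q) =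
  (λ b → let a , e = q b in a , ≈-sym e) , (λ a → let b , e = p a in b , ≈-sym e)

≈-trans : ∀ {x y z} → x ≈ y → y ≈ z → x ≈ z
≈-trans {sup A f} {sup B g} {sup C h} (p , q) (r , s) =
  (λ a → let b , e = p a ; c , e′ = r b in c , ≈-trans e e′) ,
  (λ c → let b , e = s c ; a , e′ = q b in a , ≈-trans e′ e)

∈-respˡ-≈ : ∀ {x y z} → x ≈ y → x ∈ z → y ∈ z
∈-respˡ-≈ e (i , e′) = i , ≈-trans (≈-sym e) e′

∈-respʳ-≈ : ∀ {x y z} → y ≈ z → x ∈ y → x ∈ z
∈-respʳ-≈ {y = sup A f} {sup B g} (p , _) (i , e) =
  let j , e′ = p i in j , ≈-trans e e′

-- Truth values and the propositions they reflect.

xor-cancelʳ : ∀ a b c → a xor c ≡ b xor c → a ≡ b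
xor-cancelʳ false false c     _ = refl
xor-cancelʳ true  true  c     _ = refl
xor-cancelʳ false true  false ()
xor-cancelʳ false true  true  ()
xor-cancelʳ true  false false ()
xor-cancelʳ true  false true  ()

xor-xorʳ : ∀ a b → (a xor b) xor b ≡ a
xor-xorʳ a b = trans (xor-assoc a b b) (trans (cong (a xor_) (xor-same b)) (xor-identityʳ a))

≡-from-true : ∀ {a b : Bool} → (a ≡ true → b ≡ true) → (b ≡ true → a ≡ true) → a ≡ b
≡-from-true {true}  {b}     f g = sym (f refl)
≡-from-true {false} {false} f g = refl
≡-from-true {false} {true}  f g = g refl

reflects-map : ∀ {P Q : Set} {b} → P ⇔ Q → Reflects P b → Reflects Q b
reflects-map e (ofʸ p)  = ofʸ (to e p)
reflects-map e (ofⁿ ¬p) = ofⁿ (¬p ∘′ from e)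

reflects-true : ∀ {P : Set} {b} → Reflects P b → P ⇔ b ≡ true
reflects-true (ofʸ p)  = mk⇔ (λ _ → refl) (λ _ → p)
reflects-true (ofⁿ ¬p) = mk⇔ (λ p → contradiction p ¬p) (λ ())

-- The reflected type is `Sat` of `φ xorᶠ ψ` unfolded, so this chains with the library's lemmas for
-- the other connectives and formulas are evaluated connective by connective.
_xor-reflects_ : ∀ {P Q : Set} {a b} → Reflects P a → Reflects Q b →
                 Reflects ((P × ¬ Q) ⊎ (¬ P × Q)) (a xor b)
ofʸ p  xor-reflects ofʸ q  = ofⁿ [ (λ (_ , ¬q) → ¬q q) , (λ (¬p , _) → ¬p p) ]′
ofʸ p  xor-reflects ofⁿ ¬q = ofʸ (inj₁ (p , ¬q))
ofⁿ ¬p xor-reflects ofʸ q  = ofʸ (inj₂ (¬p , q))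
ofⁿ ¬p xor-reflects ofⁿ ¬q = ofⁿ [ (λ (p , _) → ¬p p) , (λ (_ , q) → ¬q q) ]′

-- Turns satisfaction of `⇔ᶠ` into an equation of truth values, the form in which classes are
-- compared.
reflects-⇔-≡ : ∀ {P Q : Set} {a b} → Reflects P a → Reflects Q b →
               ((P → Q) × (Q → P)) ⇔ (a ≡ b)
reflects-⇔-≡ r s = mk⇔
  (λ (f , g) → det (reflects-map (mk⇔ f g) r) s)
  (λ { refl → from (reflects-true s) ∘′ to (reflects-true r) ,
              from (reflects-true r) ∘′ to (reflects-true s) })

-- Formulas for the coding of classes.

¬ᶠ_ : ∀ {n} → Formula n → Formula n
¬ᶠ φ = φ ⇒ᶠ ⊥ᶠ

_⇔ᶠ_ _xorᶠ_ : ∀ {n} → Formula n → Formula n → Formula n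
φ ⇔ᶠ ψ   = (φ ⇒ᶠ ψ) ∧ᶠ (ψ ⇒ᶠ φ)
φ xorᶠ ψ = (φ ∧ᶠ (¬ᶠ ψ)) ∨ᶠ ((¬ᶠ φ) ∧ᶠ ψ)

-- Serves `coded`, where truth values computed outside `M` enter a separation formula.
constᶠ : ∀ {n} → Bool → Formula n
constᶠ true  = ¬ᶠ ⊥ᶠ
constᶠ false = ⊥ᶠ

-- t and u are the variables of the two tags.
module _ {n} (t u : Fin n) where

  tagᶠ : Fin n → Formula n
  tagᶠ w = (w ≈ᶠ t) ∨ᶠ (w ≈ᶠ u)

  -- `α` and `β` say which parts are taken: memberships of the tags in `χᶠ`, constants in `coded`.
  κᶠ : Formula n → Formula n → Fin n → Formula n
  κᶠ α β w = (¬ᶠ tagᶠ w) ∧ᶠ (((t ∈ᶠ w) ∧ᶠ α) ∨ᶠ ((¬ᶠ (t ∈ᶠ w)) ∧ᶠ β))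

  χᶠ : Fin n → Fin n → Formula n
  χᶠ z w = (w ∈ᶠ z) xorᶠ κᶠ (t ∈ᶠ z) (u ∈ᶠ z) w

module Classical (em : ∀ ℓ → ExcludedMiddle ℓ) (M : V) where

  private
    infix 4 _≃_ _∊_
    _≃_ _∊_ : Rel (El M) 0ℓ
    _≃_ = Eq M
    _∊_ = Mem M

  ∊-resp : ∀ {z z′ w w′} → z ≃ z′ → w ≃ w′ → w ∊ z → w′ ∊ z′
  ∊-resp {z} {z′} {w} {w′} p q h =
    ∈-respˡ-≈ {z = M ⟨ z′ ⟩} q (∈-respʳ-≈ {M ⟨ w ⟩} p h)

  truth : Set → Bool
  truth P = does (em 0ℓ {P})

  truth-reflects : ∀ P → Reflects P (truth P)
  truth-reflects P = proof (em 0ℓ {P})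

  truth-cong : ∀ {P Q} → (P → Q) → (Q → P) → truth P ≡ truth Q
  truth-cong f g = det (reflects-map (mk⇔ f g) (truth-reflects _)) (truth-reflects _)

  truth-true : ∀ {P} → P → truth P ≡ true
  truth-true = to (reflects-true (truth-reflects _))

  truth-false : ∀ {P} → ¬ P → truth P ≡ false
  truth-false ¬p = det (truth-reflects _) (ofⁿ ¬p)

  truth⁻¹ : ∀ {P} → truth P ≡ true → P
  truth⁻¹ = from (reflects-true (truth-reflects _))

  mem : El M → El M → Bool
  mem z w = truth (w ∊ z)

  mem-cong : ∀ {z z′ w w′} → z ≃ z′ → w ≃ w′ → mem z w ≡ mem z′ w′
  mem-cong p q = truth-cong
    (∊-resp p q)
    (∊-resp (≈-sym p) (≈-sym q))

  -- Coding classes by sets.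

  module Coding (t₀ t₁ : El M) where

    Tag : El M → Set
    Tag w = w ≃ t₀ ⊎ w ≃ t₁

    tag : El M → Bool
    tag w = truth (Tag w)

    -- Each tag stands for one part of `M`; this picks the tag of the part in which `w` lies.
    τ : El M → El M
    τ w = if mem w t₀ then t₀ else t₁

    -- The union of the parts selected by the bits `a` and `b`. Tags are left out, so that the bits
    -- of a code can be read off from its class.
    κ : Bool → Bool → El M → Bool
    κ a b w = not (tag w) ∧ ((mem w t₀ ∧ a) ∨ (not (mem w t₀) ∧ b))

    -- A set z codes the class χ z.  Off the tags it is the symmetric difference
    -- of z and the union of those parts {w | t₀ ∈ w} and {w | t₀ ∉ w} whose tag,
    -- t₀ or t₁, belongs to z.
    χ : El M → El M → Bool
    χ z w = mem z w xor κ (mem z t₀) (mem z t₁) w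

    Tag-resp : ∀ {v w} → v ≃ w → Tag v → Tag w
    Tag-resp e = [ inj₁ ∘′ ≈-trans (≈-sym e) , inj₂ ∘′ ≈-trans (≈-sym e) ]′

    κ-cong : ∀ a b {w w′} → w ≃ w′ → κ a b w ≡ κ a b w′
    κ-cong a b {w} {w′} e = cong₂ (λ g e → not g ∧ ((e ∧ a) ∨ (not e ∧ b)))
      (truth-cong (Tag-resp e) (Tag-resp (≈-sym e))) (mem-cong e ≈-refl)

    χ-cong : ∀ {z z′ w w′} → z ≃ z′ → w ≃ w′ → χ z w ≡ χ z′ w′
    χ-cong {z} {z′} {w} {w′} p q
      rewrite mem-cong {z} {z′} p q
            | mem-cong {z} {z′} p (≈-refl {M ⟨ t₀ ⟩})
            | mem-cong {z} {z′} p (≈-refl {M ⟨ t₁ ⟩})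
      = cong (mem z′ w′ xor_) (κ-cong _ _ q)

    κ-tag : ∀ a b {w} → Tag w → κ a b w ≡ false
    κ-tag a b t rewrite truth-true t = refl

    χ-tag : ∀ z {w} → Tag w → χ z w ≡ mem z w
    χ-tag z {w} t = trans (cong (mem z w xor_) (κ-tag _ _ t)) (xor-identityʳ _)

    κ-false : ∀ w → κ false false w ≡ false
    κ-false w rewrite ∧-zeroʳ (mem w t₀) | ∧-zeroʳ (not (mem w t₀)) = ∧-zeroʳ (not (tag w))

    τ-tag : ∀ w → Tag (τ w)
    τ-tag w with mem w t₀
    ... | true  = inj₁ ≈-refl
    ... | false = inj₂ ≈-refl

    tag-of-part : ∀ {w} → Tag w → ∃[ e ] (if e then t₀ else t₁) ≃ w
    tag-of-part (inj₁ w≃t₀) = true , ≈-sym w≃t₀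
    tag-of-part (inj₂ w≃t₁) = false , ≈-sym w≃t₁

    κ-nontag : ∀ (F : El M → Bool) {w} → ¬ Tag w → κ (F t₀) (F t₁) w ≡ F (τ w)
    κ-nontag F {w} ¬t rewrite truth-false ¬t with mem w t₀
    ... | true  = ∨-identityʳ _
    ... | false = refl

    χ-outside : ∀ z {w} → ¬ Tag w → ¬ w ∊ z → χ z w ≡ mem z (τ w)
    χ-outside z ¬t w∉z rewrite truth-false w∉z = κ-nontag (mem z) ¬t

    -- Outside the code only `κ` contributes to `χ`, and its bits are the values at the tags. So a
    -- tag records what the class is on its part up to a set; `coded` is a converse for definable
    -- classes.
    χ-τ : ∀ z {w} → ¬ Tag w → ¬ w ∊ z → χ z w ≡ χ z (τ w)
    χ-τ z {w} ¬t w∉z = trans (χ-outside z ¬t w∉z) (sym (χ-tag z (τ-tag w)))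

    -- At the tags `χ` is membership in the code, so equal classes have equal bits; their `κ` terms
    -- then coincide and cancel.
    χ-injective-mem : ∀ {z z′} → (∀ w → χ z w ≡ χ z′ w) → ∀ w → mem z w ≡ mem z′ w
    χ-injective-mem {z} {z′} eq w =
      xor-cancelʳ _ _ (κ (mem z t₀) (mem z t₁) w)
        (trans (eq w) (cong₂ (λ a b → mem z′ w xor κ a b w)
          (sym (at (inj₁ ≈-refl))) (sym (at (inj₂ ≈-refl)))))
      where
      at : ∀ {t} → Tag t → mem z t ≡ mem z′ t
      at {t} h = trans (sym (χ-tag z h)) (trans (eq t) (χ-tag z′ h))

  -- Definability of the coding.

  open Coding using (κ; χ)

  const-reflects : ∀ {n} (ρ : Vec (El M) n) b → Reflects (Sat M (constᶠ b) ρ) b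
  const-reflects ρ true  = ofʸ (λ ())
  const-reflects ρ false = ofⁿ (λ ())

  module _ {n} (ρ : Vec (El M) n) (t u : Fin n) where

    κ-reflects : ∀ {α β a b} → Reflects (Sat M α ρ) a → Reflects (Sat M β ρ) b → ∀ w →
                 Reflects (Sat M (κᶠ t u α β w) ρ)
                          (κ (lookup ρ t) (lookup ρ u) a b (lookup ρ w))
    κ-reflects r s w =
      ¬-reflects (truth-reflects _) ×-reflects
        ((truth-reflects _ ×-reflects r) ⊎-reflects
         (¬-reflects (truth-reflects _) ×-reflects s))

    χ-reflects : ∀ z w → Reflects (Sat M (χᶠ t u z w) ρ)
                                  (χ (lookup ρ t) (lookup ρ u) (lookup ρ z) (lookup ρ w))
    χ-reflects z w =
      truth-reflects _ xor-reflects κ-reflects {t ∈ᶠ z} {u ∈ᶠ z} (truth-reflects _) (truth-reflects _) w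

  -- Set operations in `M`.

  module Construction (ZF : ModelOfZF⁻ M) where

    open ModelOfZF⁻ ZF

    ≃-ext : ∀ {x y} → (∀ w → mem x w ≡ mem y w) → x ≃ y
    ≃-ext {x} {y} eq = extensionality x y λ w → mk⇔
      (λ h → truth⁻¹ (trans (sym (eq w)) (truth-true h)))
      (λ h → truth⁻¹ (trans (eq w) (truth-true h)))

    pair : El M → El M → El M
    pair x y = proj₁ (pairing x y)

    ∊-pair : ∀ {x y} z → z ∊ pair x y ⇔ (z ≃ x ⊎ z ≃ y)
    ∊-pair {x} {y} = proj₂ (pairing x y)

    ⋃ : El M → El M
    ⋃ x = proj₁ (union x)

    ∊-⋃ : ∀ {x} z → z ∊ ⋃ x ⇔ (∃[ y ] y ∊ x × z ∊ y)
    ∊-⋃ {x} = proj₂ (union x)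

    _∪_ : El M → El M → El M
    x ∪ y = ⋃ (pair x y)

    ∊-∪ˡ : ∀ x y {z} → z ∊ x → z ∊ (x ∪ y)
    ∊-∪ˡ x y h = from (∊-⋃ _) (x , from (∊-pair x) (inj₁ ≈-refl) , h)

    ∊-∪ʳ : ∀ x y {z} → z ∊ y → z ∊ (x ∪ y)
    ∊-∪ʳ x y h = from (∊-⋃ _) (y , from (∊-pair y) (inj₂ ≈-refl) , h)

    -- Russell's argument: `r` collects the elements of `x` that are not elements of themselves.
    -- Then `r ∊ r` is impossible, and so `r ∊ x` would put `r` into itself.
    fresh : ∀ x → ∃[ r ] ¬ r ∊ x
    fresh x = let r , ∊r = separation (¬ᶠ (0F ∈ᶠ 0F)) [] x in
      r , λ r∊x → let r∉r = λ r∊r → proj₂ (to (∊r r) r∊r) r∊r in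
        r∉r (from (∊r r) (r∊x , r∉r))

    -- Proper parts, coded classes and the forcing.

    module Algebras (t₀ t₁ : El M) (t₀≄t₁ : ¬ t₀ ≃ t₁) where

      open Coding t₀ t₁ hiding (κ; χ)
      open Coding t₀ t₁ using () renaming (κ to κ₂; χ to χ₂)

      tags : El M
      tags = pair t₀ t₁

      χ-injective : ∀ {z z′} → (∀ w → χ₂ z w ≡ χ₂ z′ w) → z ≃ z′
      χ-injective = ≃-ext ∘′ χ-injective-mem

      -- A set with an element `r` outside `⋃ (z ∪ tags)` cannot belong to `z ∪ tags`. Both
      -- `pair t₀ r` and `pair r r` are such sets, and they lie in different parts once `r` differs
      -- from `t₀`.
      parts-proper : ∀ z e → ∃[ w ] ¬ Tag w × mem w t₀ ≡ e × ¬ w ∊ z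
      parts-proper z e =
        w e , w∉ ∘′ ∊-∪ʳ z tags ∘′ from (∊-pair (w e)) , t₀∊w e , w∉ ∘′ ∊-∪ˡ z tags
        where
        bound : El M
        -- The last union keeps `r` distinct from `t₀`.
        bound = ⋃ (z ∪ tags) ∪ tags
        r : El M
        r = proj₁ (fresh bound)
        w : Bool → El M
        w e = if e then pair t₀ r else pair r r
        r≄t₀ : ¬ t₀ ≃ r
        r≄t₀ h = proj₂ (fresh bound) (∊-∪ʳ _ tags (from (∊-pair r) (inj₁ (≈-sym h))))
        t₀∊w : ∀ e → mem (w e) t₀ ≡ e
        t₀∊w true  = truth-true (from (∊-pair t₀) (inj₁ ≈-refl))
        t₀∊w false = truth-false ([ r≄t₀ , r≄t₀ ]′ ∘′ to (∊-pair t₀))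
        r∊w : ∀ e → r ∊ w e
        r∊w true  = from (∊-pair r) (inj₂ ≈-refl)
        r∊w false = from (∊-pair r) (inj₂ ≈-refl)
        w∉ : ¬ w e ∊ (z ∪ tags)
        w∉ h = proj₂ (fresh bound) (∊-∪ˡ _ tags (from (∊-⋃ r) (w e , h , r∊w e)))

      -- The code is the symmetric difference of `F` and `κF`, the union of the parts whose tags lie
      -- in `F`. Outside `u` and the tags these two agree, so separation yields the difference as a
      -- set. Since `κF` vanishes at the tags, the code has the bits of `F`, and decoding adds `κF`
      -- a second time.
      coded : (F : El M → Bool) → ∀ {n} (φ : Formula (3 + n)) (p : Vec (El M) n) →
              (∀ w → Reflects (Sat M φ (w ∷ t₀ ∷ t₁ ∷ p)) (F w)) →
              (u : El M) → (∀ {w} → ¬ Tag w → ¬ w ∊ u → F w ≡ F (τ w)) →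
              ∃[ z ] ∀ w → χ₂ z w ≡ F w
      coded F φ p r u off-u = z , λ w → begin
        mem z w xor κ₂ (mem z t₀) (mem z t₁) w
          ≡⟨ cong₂ (λ a b → mem z w xor κ₂ a b w)
               (mem-tag (inj₁ ≈-refl)) (mem-tag (inj₂ ≈-refl)) ⟩
        mem z w xor κF w         ≡⟨ cong (_xor κF w) (mem-z w) ⟩
        (F w xor κF w) xor κF w  ≡⟨ xor-xorʳ (F w) (κF w) ⟩
        F w                      ∎
        where
        open ≡-Reasoning
        κF : El M → Bool
        κF = κ₂ (F t₀) (F t₁)
        ψ = φ xorᶠ κᶠ 1F 2F (constᶠ (F t₀)) (constᶠ (F t₁)) 0F
        -- The bound includes the tags, because `z` has to record the values of `F` there.
        separated = separation ψ (t₀ ∷ t₁ ∷ p) (u ∪ tags)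
        z = proj₁ separated
        ψ-reflects : ∀ w → Reflects (Sat M ψ (w ∷ t₀ ∷ t₁ ∷ p)) (F w xor κF w)
        ψ-reflects w = r w xor-reflects κ-reflects ρ 1F 2F {α = constᶠ (F t₀)} {constᶠ (F t₁)}
          (const-reflects ρ (F t₀)) (const-reflects ρ (F t₁)) 0F
          where ρ = w ∷ t₀ ∷ t₁ ∷ p
        mem-z : ∀ w → mem z w ≡ F w xor κF w
        mem-z w with em 0ℓ {w ∊ (u ∪ tags)}
        ... | yes w∊ = det
          (reflects-map (mk⇔ (proj₂ ∘′ to (proj₂ separated w))
                            (λ s → from (proj₂ separated w) (w∊ , s)))
            (truth-reflects _))
          (ψ-reflects w)
        ... | no w∉ = begin
          mem z w          ≡⟨ truth-false (w∉ ∘′ proj₁ ∘′ to (proj₂ separated w)) ⟩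
          false            ≡⟨ xor-same (F w) ⟨
          F w xor F w      ≡⟨ cong (F w xor_) (off-u nontag (w∉ ∘′ ∊-∪ˡ u tags)) ⟩
          F w xor F (τ w)  ≡⟨ cong (F w xor_) (κ-nontag F nontag) ⟨
          F w xor κF w     ∎
          where
          nontag : ¬ Tag w
          nontag = w∉ ∘′ ∊-∪ʳ u tags ∘′ from (∊-pair w)
        mem-tag : ∀ {t} → Tag t → mem z t ≡ F t
        mem-tag {t} h = trans (mem-z t) (trans (cong (F t xor_) (κ-tag _ _ h)) (xor-identityʳ (F t)))

      -- Tags are kept out of the conditions, since the value of a coded class at a tag describes a
      -- whole part up to a set.
      forcing : ClassForcing M
      forcing = record
        { Dom            = λ w → ¬ Tag w
        ; _≤_            = _≃_ on proj₁
        ; isPartialOrder = record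
          { isPreorder = record
            { isEquivalence = record { refl = ≈-refl ; sym = ≈-sym ; trans = ≈-trans }
            ; reflexive     = λ e → e
            ; trans         = ≈-trans
            }
          ; antisym = λ e _ → e
          }
        ; Dom-definable  = 2 , ¬ᶠ tagᶠ 1F 2F 0F , t₀ ∷ t₁ ∷ [] , λ { (x ∷ []) → mk⇔ (λ h → h) (λ h → h) }
        ; ≤-definable    = 2 , (¬ᶠ tagᶠ 2F 3F 0F) ∧ᶠ (0F ≈ᶠ 1F) , t₀ ∷ t₁ ∷ [] ,
            λ { (x ∷ y ∷ []) → mk⇔
            (λ { ((a , a-nontag) , _ , x≃a , y≃b , a≃b) →
                 a-nontag ∘′ Tag-resp x≃a ,
                 ≈-trans x≃a (≈-trans a≃b (≈-sym y≃b)) })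
            (λ { (h , x≃y) → (x , h) , (x , h) , ≈-refl , ≈-sym x≃y , ≈-refl }) }
        }

      -- For s = t₁ the coded classes are the sets and their complements; for
      -- s = t₀ the condition is void.
      module Completion (s : El M) (s-tag : Tag s) where

        Dom : Pred (El M) 0ℓ
        Dom z = mem z t₀ ≡ mem z s

        Carrier : Set
        Carrier = Members M Dom

        infix 4 _≋_
        _≋_ : Rel Carrier 0ℓ
        _≋_ = EqOn M Dom

        -- At the tags a class and its code agree, so lying in `Dom` depends on the class alone and
        -- is easily checked for classes that are built pointwise.
        Dom-χ : ∀ {z} → χ₂ z t₀ ≡ χ₂ z s ⇔ Dom z
        Dom-χ {z} = mk⇔
          (λ eq → trans (sym (χ-tag z (inj₁ ≈-refl))) (trans eq (χ-tag z s-tag)))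
          (λ eq → trans (χ-tag z (inj₁ ≈-refl)) (trans eq (sym (χ-tag z s-tag))))

        Dom-resp : ∀ {x y} → x ≃ y → Dom x → Dom y
        Dom-resp e d = trans (mem-cong (≈-sym e) ≈-refl) (trans d (mem-cong e ≈-refl))

        class : Carrier → El M → Bool
        class a = χ₂ (proj₁ a)

        class-injective : ∀ {a b} → (∀ w → class a w ≡ class b w) → a ≋ b
        class-injective = χ-injective

        class-τ : ∀ (a : Carrier) {u w} → (∀ {v} → v ∊ proj₁ a → v ∊ u) →
                  ¬ Tag w → ¬ w ∊ u → class a w ≡ class a (τ w)
        class-τ a a⊆u nontag w∉u = χ-τ (proj₁ a) nontag (w∉u ∘′ a⊆u)

        element : (F : El M → Bool) → F t₀ ≡ F s → (∃[ z ] ∀ w → χ₂ z w ≡ F w) →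
                  ∃[ a ] ∀ w → class a w ≡ F w
        element F eq (z , χz≡F) = (z , to Dom-χ (trans (χz≡F t₀) (trans eq (sym (χz≡F s))))) , χz≡F

        -- Pointwise operations and their definability.

        domᶠ : ∀ {n} → Fin n → Fin n → Fin n → Formula n
        domᶠ t s z = (t ∈ᶠ z) ⇔ᶠ (s ∈ᶠ z)

        domᶠ-⇔ : ∀ {z} → (((t₀ ∊ z → s ∊ z) × (s ∊ z → t₀ ∊ z)) ⇔ Dom z)
        domᶠ-⇔ = reflects-⇔-≡ (truth-reflects _) (truth-reflects _)

        -- Existence of the resulting code and definability of the graph are proved once, for every
        -- truth function that a connective `fᶠ` expresses.
        module Operation (f : Bool → Bool → Bool) (fᶠ : ∀ {n} → Formula n → Formula n → Formula n)
          (f-reflects : ∀ {n} (ρ : Vec (El M) n) φ ψ {a b} →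
            Reflects (Sat M φ ρ) a → Reflects (Sat M ψ ρ) b → Reflects (Sat M (fᶠ φ ψ) ρ) (f a b)) where

          private
            result : ∀ a b → ∃[ c ] ∀ w → class c w ≡ f (class a w) (class b w)
            result a b = element F
              (cong₂ f (from Dom-χ (proj₂ a)) (from Dom-χ (proj₂ b)))
              (coded F (fᶠ (χᶠ 1F 2F 3F 0F) (χᶠ 1F 2F 4F 0F)) (x ∷ y ∷ [])
                (λ w → let ρ = w ∷ t₀ ∷ t₁ ∷ x ∷ y ∷ [] in
                  f-reflects ρ (χᶠ 1F 2F 3F 0F) (χᶠ 1F 2F 4F 0F)
                    (χ-reflects ρ 1F 2F 3F 0F) (χ-reflects ρ 1F 2F 4F 0F))
                -- Outside both codes and the tags each class has its value at `τ w`, hence so does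
                -- their combination.
                (x ∪ y)
                (λ nontag w∉ → cong₂ f (class-τ a (∊-∪ˡ x y) nontag w∉) (class-τ b (∊-∪ʳ x y) nontag w∉)))
              where
              x = proj₁ a
              y = proj₁ b
              F : El M → Bool
              F w = f (class a w) (class b w)

          _∙_ : Op₂ Carrier
          a ∙ b = proj₁ (result a b)

          ∙-class : ∀ a b w → class (a ∙ b) w ≡ f (class a w) (class b w)
          ∙-class a b = proj₂ (result a b)

          -- A code is determined by its class, so the graph is described by comparing classes
          -- pointwise over `M`; that `z` lies in `Dom` then follows.
          ∙-graph : ∀ {x y z} → Graph₂ M {Dom} _∙_ x y z ⇔
                    (Dom x × Dom y × ∀ w → χ₂ z w ≡ f (χ₂ x w) (χ₂ y w))
          ∙-graph = mk⇔
            (λ { (a , b , x≃ , y≃ , z≃) →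
              Dom-resp (≈-sym x≃) (proj₂ a) , Dom-resp (≈-sym y≃) (proj₂ b) ,
              λ w → trans (χ-cong z≃ ≈-refl) (trans (∙-class a b w)
                (cong₂ f (χ-cong (≈-sym x≃) ≈-refl) (χ-cong (≈-sym y≃) ≈-refl))) })
            (λ { (dx , dy , eq) → (_ , dx) , (_ , dy) , ≈-refl , ≈-refl ,
              χ-injective (λ w → trans (eq w) (sym (∙-class (_ , dx) (_ , dy) w))) })

          ∙-definable : Definable M 3 (Graph₂ M {Dom} _∙_)
          -- The variables are `x`, `y`, `z`, `t₀`, `t₁`, `s`; under the quantifier each index is
          -- one higher.
          ∙-definable = 3 , domᶠ 3F 5F 0F ∧ᶠ (domᶠ 3F 5F 1F ∧ᶠ
              ∀ᶠ (χᶠ 4F 5F 3F 0F ⇔ᶠ fᶠ (χᶠ 4F 5F 1F 0F) (χᶠ 4F 5F 2F 0F))) ,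
            t₀ ∷ t₁ ∷ s ∷ [] , λ { (x ∷ y ∷ z ∷ []) →
              let pointwise w =
                    let ρ = w ∷ x ∷ y ∷ z ∷ t₀ ∷ t₁ ∷ s ∷ [] in
                    reflects-⇔-≡ (χ-reflects ρ 4F 5F 3F 0F)
                      (f-reflects ρ (χᶠ 4F 5F 1F 0F) (χᶠ 4F 5F 2F 0F)
                        (χ-reflects ρ 4F 5F 1F 0F) (χ-reflects ρ 4F 5F 2F 0F)) in
              mk⇔
                (λ g → let dx , dy , eq = to ∙-graph g in
                  from domᶠ-⇔ dx , from domᶠ-⇔ dy , λ w → from (pointwise w) (eq w))
                (λ (dx , dy , eq) → from ∙-graph
                  (to domᶠ-⇔ dx , to domᶠ-⇔ dy , λ w → to (pointwise w) (eq w))) }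

        module Join = Operation _∨_ _∨ᶠ_ (λ _ _ _ → _⊎-reflects_)
        module Meet = Operation _∧_ _∧ᶠ_ (λ _ _ _ → _×-reflects_)
        -- Presented as a binary truth function so that `Operation` applies; `∁` evaluates it on the
        -- diagonal.
        module Complement = Operation (λ a _ → not a) (λ φ _ → ¬ᶠ φ) (λ _ _ _ r _ → ¬-reflects r)

        open Join public using () renaming (_∙_ to _⊔_; ∙-class to ⊔-class)
        open Meet public using () renaming (_∙_ to _⊓_; ∙-class to ⊓-class)

        ∁ : Carrier → Carrier
        ∁ a = a Complement.∙ a

        ∁-class : ∀ a w → class (∁ a) w ≡ not (class a w)
        ∁-class a = Complement.∙-class a a

        ∁-definable : Definable M 2 (Graph₁ M {Dom} {Dom} ∁)
        ∁-definable = 3 , domᶠ 2F 4F 0F ∧ᶠ ∀ᶠ (χᶠ 3F 4F 2F 0F ⇔ᶠ (¬ᶠ χᶠ 3F 4F 1F 0F)) ,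
          t₀ ∷ t₁ ∷ s ∷ [] , λ { (x ∷ y ∷ []) →
            let pointwise w =
                  let ρ = w ∷ x ∷ y ∷ t₀ ∷ t₁ ∷ s ∷ [] in
                  reflects-⇔-≡ (χ-reflects ρ 3F 4F 2F 0F) (¬-reflects (χ-reflects ρ 3F 4F 1F 0F)) in
            mk⇔
              (λ { (a , x≃ , y≃) →
                from domᶠ-⇔ (Dom-resp (≈-sym x≃) (proj₂ a)) ,
                λ w → from (pointwise w) (trans (χ-cong y≃ ≈-refl)
                  (trans (∁-class a w) (cong not (χ-cong (≈-sym x≃) ≈-refl)))) })
              (λ { (d , eq) →
                let a = x , to domᶠ-⇔ d in
                a , ≈-refl , χ-injective (λ w → trans (to (pointwise w) (eq w)) (sym (∁-class a w))) }) }

        constant : ∀ b → ∃[ a ] ∀ w → class a w ≡ b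
        constant b = element (λ _ → b) refl
          -- A constant takes its tag value everywhere, so any set can be the bound; `t₀` is one.
          (coded (λ _ → b) (constᶠ b) [] (λ w → const-reflects (w ∷ t₀ ∷ t₁ ∷ []) b) t₀ (λ _ _ → refl))

        𝟙 𝟘 : Carrier
        𝟙 = proj₁ (constant true)
        𝟘 = proj₁ (constant false)

        classes : RawLattice 0ℓ 0ℓ
        classes = record
          { Carrier = El M → Bool
          ; _≈_     = λ F G → ∀ w → F w ≡ G w
          ; _∧_     = λ F G w → F w ∧ G w
          ; _∨_     = λ F G w → F w ∨ G w
          }

        open RawLattice classes using () renaming (_≈_ to _≗_; _∨_ to _∨′_; _∧_ to _∧′_)

        classes-isDistributiveLattice : IsDistributiveLattice _≗_ _∨′_ _∧′_
        classes-isDistributiveLattice = record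
          { isLattice = record
            { isEquivalence = record
              { refl  = λ _ → refl
              ; sym   = λ p w → sym (p w)
              ; trans = λ p q w → trans (p w) (q w)
              }
            ; ∨-comm  = λ F G w → ∨-comm (F w) (G w)
            ; ∨-assoc = λ F G H w → ∨-assoc (F w) (G w) (H w)
            ; ∨-cong  = λ p q w → cong₂ _∨_ (p w) (q w)
            ; ∧-comm  = λ F G w → ∧-comm (F w) (G w)
            ; ∧-assoc = λ F G H w → ∧-assoc (F w) (G w) (H w)
            ; ∧-cong  = λ p q w → cong₂ _∧_ (p w) (q w)
            ; absorptive = (λ F G w → ∨-abs-∧ (F w) (G w)) , (λ F G w → ∧-abs-∨ (F w) (G w))
            }
          ; ∨-distrib-∧ =
            (λ F G H w → ∨-distribˡ-∧ (F w) (G w) (H w)) ,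
            (λ F G H w → ∨-distribʳ-∧ (F w) (G w) (H w))
          ; ∧-distrib-∨ =
            (λ F G H w → ∧-distribˡ-∨ (F w) (G w) (H w)) ,
            (λ F G H w → ∧-distribʳ-∨ (F w) (G w) (H w))
          }

        -- Embeds the codes into the pointwise lattice of truth-valued functions on `M`, so that the
        -- distributive lattice laws are inherited from `Bool`.
        class-isLatticeMonomorphism :
          IsLatticeMonomorphism (record { _≈_ = _≋_ ; _∧_ = _⊓_ ; _∨_ = _⊔_ }) classes class
        class-isLatticeMonomorphism = record
          { isLatticeHomomorphism = record
            { isRelHomomorphism = record { cong = λ e w → χ-cong e ≈-refl }
            ; ∧-homo = ⊓-class
            ; ∨-homo = ⊔-class
            }
          ; injective = λ {a} {b} → class-injective {a} {b}
          }

        isBooleanAlgebra : IsBooleanAlgebra _≋_ _⊔_ _⊓_ ∁ 𝟙 𝟘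
        isBooleanAlgebra = record
          { isDistributiveLattice = isDistributiveLattice class-isLatticeMonomorphism classes-isDistributiveLattice
          ; ∨-complement =
            (λ a → law (∁ a ⊔ a) true λ w → trans (⊔-class (∁ a) a w)
              (trans (cong (_∨ class a w) (∁-class a w)) (∨-inverseˡ (class a w)))) ,
            (λ a → law (a ⊔ ∁ a) true λ w → trans (⊔-class a (∁ a) w)
              (trans (cong (class a w ∨_) (∁-class a w)) (∨-inverseʳ (class a w))))
          ; ∧-complement =
            (λ a → law (∁ a ⊓ a) false λ w → trans (⊓-class (∁ a) a w)
              (trans (cong (_∧ class a w) (∁-class a w)) (∧-inverseˡ (class a w)))) ,
            (λ a → law (a ⊓ ∁ a) false λ w → trans (⊓-class a (∁ a) w)
              (trans (cong (class a w ∧_) (∁-class a w)) (∧-inverseʳ (class a w))))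
          ; ¬-cong = λ {a} {b} e → χ-injective λ w →
              trans (∁-class a w) (trans (cong not (χ-cong e ≈-refl)) (sym (∁-class b w)))
          }
          where
          law : ∀ a b → (∀ w → class a w ≡ b) → a ≋ proj₁ (constant b)
          law a b eq = χ-injective λ w → trans (eq w) (sym (proj₂ (constant b) w))

        point-definable : ∀ a → Definable M 1 (λ x → x ≃ a)
        point-definable a = 1 , (0F ≈ᶠ 1F) , a ∷ [] , λ { (x ∷ []) → mk⇔ (λ h → h) (λ h → h) }

        algebra : DefinableBooleanAlgebra M
        algebra = record
          { Dom              = Dom
          ; isBooleanAlgebra = isBooleanAlgebra
          ; Dom-definable    = 2 , domᶠ 1F 2F 0F , t₀ ∷ s ∷ [] ,
              λ { (x ∷ []) → mk⇔ (from domᶠ-⇔) (to domᶠ-⇔) }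
          ; ∨-definable      = Join.∙-definable
          ; ∧-definable      = Meet.∙-definable
          ; ∁-definable      = ∁-definable
          ; 𝟙-definable      = point-definable (proj₁ 𝟙)
          ; 𝟘-definable      = point-definable (proj₁ 𝟘)
          }

        -- Order and suprema.

        open DefinableBooleanAlgebra algebra using (_≤_; M-complete)

        ≤-class : ∀ {a b} → a ≤ b ⇔ (∀ w → class a w ≡ true → class b w ≡ true)
        ≤-class {a} {b} = mk⇔
          (λ e w aw → trans (sym (cong (_∧ class b w) aw))
            (trans (sym (trans (χ-cong e ≈-refl) (⊓-class a b w))) aw))
          (λ a≤b → χ-injective λ w → ≡-from-true
            (λ aw → trans (⊓-class a b w) (cong₂ _∧_ aw (a≤b w aw)))
            (λ abw → ∧-conicalˡ (class a w) (class b w) (trans (sym (⊓-class a b w)) abw)))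

        -- The supremum is the union of the classes coded in `A`, which is definable from `A`.
        -- Outside the tags and the set `⋃ A`, every class in the family has its value at `τ w`,
        -- hence so does the union, and `coded` applies.
        complete : M-complete
        complete A A⊆Dom = sup′ , upper , least
          where
          φ : Formula 4
          φ = ∃ᶠ ((0F ∈ᶠ 4F) ∧ᶠ χᶠ 2F 3F 0F 1F)
          F : El M → Bool
          F w = truth (Sat M φ (w ∷ t₀ ∷ t₁ ∷ A ∷ []))
          χ-true : ∀ {w z} → Sat M (χᶠ 2F 3F 0F 1F) (z ∷ w ∷ t₀ ∷ t₁ ∷ A ∷ []) ⇔ χ₂ z w ≡ true
          χ-true {w} {z} = reflects-true (χ-reflects (z ∷ w ∷ t₀ ∷ t₁ ∷ A ∷ []) 2F 3F 0F 1F)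
          -- Used twice: with `t₀` and `s` for the domain condition, and with `w` and `τ w` for the
          -- bound `⋃ A`.
          F-cong : ∀ {v w} → (∀ z → z ∊ A → χ₂ z v ≡ χ₂ z w) → F v ≡ F w
          F-cong eq = truth-cong
            (λ (z , z∊A , h) → z , z∊A , from χ-true (trans (sym (eq z z∊A)) (to χ-true h)))
            (λ (z , z∊A , h) → z , z∊A , from χ-true (trans (eq z z∊A) (to χ-true h)))
          result : ∃[ a ] ∀ w → class a w ≡ F w
          result = element F (F-cong λ z z∊A → from Dom-χ (A⊆Dom z z∊A))
            (coded F φ (A ∷ []) (λ w → truth-reflects _) (⋃ A)
              (λ nontag w∉ → F-cong λ z z∊A → χ-τ z nontag
              (λ w∊z → w∉ (from (∊-⋃ _) (z , z∊A , w∊z)))))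
          sup′ : Carrier
          sup′ = proj₁ result
          upper : ∀ a → proj₁ a ∊ A → a ≤ sup′
          upper a a∊A = from (≤-class {a} {sup′}) λ w aw →
            trans (proj₂ result w) (truth-true (proj₁ a , a∊A , from χ-true aw))
          least : ∀ u → (∀ a → proj₁ a ∊ A → a ≤ u) → sup′ ≤ u
          least u u-upper = from (≤-class {sup′} {u}) λ w sw →
            let z , z∊A , zw = truth⁻¹ (trans (sym (proj₂ result w)) sw)
                a = z , A⊆Dom z z∊A
            in to (≤-class {a} {u}) (u-upper a z∊A) w (to χ-true zw)

        -- The dense embedding of the conditions.

        Condition : Set
        Condition = Members M (ClassForcing.Dom forcing)

        ∊-singleton : ∀ {x y} → x ∊ pair y y ⇔ x ≃ y
        ∊-singleton {x} = mk⇔ ([ (λ e → e) , (λ e → e) ]′ ∘′ to (∊-pair x)) (from (∊-pair x) ∘′ inj₁)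

        tag∉singleton : ∀ (p : Condition) {t} → Tag t → mem (pair (proj₁ p) (proj₁ p)) t ≡ false
        tag∉singleton (p , nontag) t-tag =
          truth-false λ h → nontag (Tag-resp (to ∊-singleton h) t-tag)

        -- The singleton of a non-tag contains no tag, so both of its bits are off: it codes itself
        -- and meets the domain condition for either choice of `s`.
        π : Condition → Carrier
        π p = pair (proj₁ p) (proj₁ p) ,
          trans (tag∉singleton p (inj₁ ≈-refl)) (sym (tag∉singleton p s-tag))

        π-class : ∀ p w → class (π p) w ≡ true ⇔ w ≃ proj₁ p
        π-class p w = mk⇔
          (λ h → to ∊-singleton (truth⁻¹ (trans (sym class≡mem) h)))
          (λ e → trans class≡mem (truth-true (from ∊-singleton e)))
          where
          class≡mem : class (π p) w ≡ mem (proj₁ (π p)) w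
          class≡mem rewrite tag∉singleton p (inj₁ ≈-refl) | tag∉singleton p (inj₂ ≈-refl) | κ-false w =
            xor-identityʳ _

        -- The class of `π p` has `proj₁ p` as its only point, so inclusion reduces to one value.
        π-≤ : ∀ {p b} → π p ≤ b ⇔ class b (proj₁ p) ≡ true
        π-≤ {p} {b} = mk⇔
          (λ p≤b → to (≤-class {π p} {b}) p≤b (proj₁ p) (from (π-class p (proj₁ p)) ≈-refl))
          (λ h → from (≤-class {π p} {b}) λ w πw →
            trans (χ-cong (≈-refl {M ⟨ proj₁ b ⟩}) (to (π-class p w) πw)) h)

        π-cong : ∀ {p q} → proj₁ p ≃ proj₁ q → π p ≋ π q
        π-cong {p} {q} e = χ-injective λ w → ≡-from-true
          (λ h → from (π-class q w) (≈-trans (to (π-class p w) h) e))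
          (λ h → from (π-class p w) (≈-trans (to (π-class q w) h) (≈-sym e)))

        π-injective : ∀ {p q} → π p ≋ π q → proj₁ p ≃ proj₁ q
        π-injective {p} {q} e = to (π-class q (proj₁ p))
          (trans (χ-cong (≈-sym e) ≈-refl) (from (π-class p (proj₁ p)) ≈-refl))

        class-𝟘 : ∀ w → ¬ class 𝟘 w ≡ true
        class-𝟘 w h with trans (sym h) (proj₂ (constant false) w)
        ... | ()

        -- A point of the class that is not a tag is itself a condition below `b`. If the point is a
        -- tag, the class contains its part up to a set, and `parts-proper` gives a condition in
        -- that part outside the code, where the class still has the tag's value.
        dense : ∀ b → ¬ b ≋ 𝟘 → ∃[ p ] π p ≤ b
        dense b b≄𝟘 with em 0ℓ {∃[ w ] class b w ≡ true}
        ... | no none = contradiction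
          (class-injective {b} {𝟘} λ w →
            ≡-from-true (λ h → contradiction (w , h) none) (λ h → contradiction h (class-𝟘 w)))
          b≄𝟘
        ... | yes (w , bw) = below (em 0ℓ)
          where
          below : Dec (Tag w) → ∃[ p ] π p ≤ b
          below (no nontag) = (w , nontag) , from (π-≤ {w , nontag} {b}) bw
          below (yes w-tag) =
            let e , tagₑ≃w = tag-of-part w-tag
                v , nontag , v∈part , v∉b = parts-proper (proj₁ b) e
            in (v , nontag) , from (π-≤ {v , nontag} {b}) (begin
              class b v                             ≡⟨ χ-outside (proj₁ b) nontag v∉b ⟩
              mem (proj₁ b) (τ v)                   ≡⟨ cong (λ e → mem (proj₁ b) (if e then t₀ else t₁)) v∈part ⟩
              mem (proj₁ b) (if e then t₀ else t₁)  ≡⟨ mem-cong (≈-refl {M ⟨ proj₁ b ⟩}) tagₑ≃w ⟩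
              mem (proj₁ b) w                       ≡⟨ χ-tag (proj₁ b) w-tag ⟨
              class b w                             ≡⟨ bw ⟩
              true                                  ∎)
            where open ≡-Reasoning

        completion : BooleanCompletion M forcing
        completion = record
          { algebra     = algebra
          ; complete    = complete
          ; π           = π
          ; π-nonzero   = λ p e → class-𝟘 (proj₁ p)
              (trans (χ-cong (≈-sym e) ≈-refl) (from (π-class p (proj₁ p)) ≈-refl))
          ; π-embedding = record
            { isOrderHomomorphism = record
              { cong = λ {p} {q} → π-cong {p} {q}
              ; mono = λ {p} {q} e → from (π-≤ {p} {π q}) (from (π-class q (proj₁ p)) e)
              }
            ; injective = λ {p} {q} → π-injective {p} {q}
            ; cancel    = λ {p} {q} h → to (π-class q (proj₁ p)) (to (π-≤ {p} {π q}) h)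
            }
          ; π-dense     = dense
          ; π-definable = 2 , (¬ᶠ tagᶠ 2F 3F 0F) ∧ᶠ ∀ᶠ ((0F ∈ᶠ 2F) ⇔ᶠ (0F ≈ᶠ 1F)) ,
              t₀ ∷ t₁ ∷ [] ,
              λ { (x ∷ y ∷ []) → mk⇔
                (λ { (p , x≃ , y≃) → proj₂ p ∘′ Tag-resp x≃ , λ w →
                  (λ w∊y → ≈-trans (to ∊-singleton (∊-resp y≃ (≈-refl {M ⟨ w ⟩}) w∊y)) (≈-sym x≃)) ,
                  (λ w≃x → ∊-resp (≈-sym y≃) (≈-refl {M ⟨ w ⟩}) (from ∊-singleton (≈-trans w≃x x≃))) })
                (λ { (nontag , eq) → (x , nontag) , ≈-refl ,
                  extensionality _ _ λ w → mk⇔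
                    (λ w∊y → from ∊-singleton (proj₁ (eq w) w∊y))
                    (λ w∊ → proj₂ (eq w) (to ∊-singleton w∊)) }) }
          }

      -- The two completions and their non-isomorphism.

      module Full  = Completion t₀ (inj₁ ≈-refl)
      module Small = Completion t₁ (inj₂ ≈-refl)

      -- Agreement on the conditions forces agreement at the tags. The two tag values of an element
      -- of `Small` are equal, whereas those of `part` differ.
      no-isomorphism : ¬ IsomorphismFixing M Small.completion Full.completion
      no-isomorphism iso = contradiction
        (begin
          true                ≡⟨ truth-true (from Full.∊-singleton ≈-refl) ⟨
          mem (proj₁ part) t₀ ≡⟨ tags-agree true ⟨
          mem (proj₁ b) t₀    ≡⟨ proj₂ b ⟩
          mem (proj₁ b) t₁    ≡⟨ tags-agree false ⟩
          mem (proj₁ part) t₁ ≡⟨ truth-false (t₀≄t₁ ∘′ ≈-sym ∘′ to Full.∊-singleton) ⟩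
          false               ∎)
        λ ()
        where
        open IsomorphismFixing iso
        open IsLatticeIsomorphism isomorphism using (∧-homo; ⟦⟧-cong; injective; surjective)
        open IsBooleanAlgebra Full.isBooleanAlgebra using (∧-cong)
        open ≡-Reasoning

        part : Full.Carrier
        -- This code switches on the bit of the first part only: its class consists of `t₀` and the
        -- non-tags that have `t₀` as an element.
        part = pair t₀ t₀ , refl

        b : Small.Carrier
        b = proj₁ (surjective part)

        fb≃part : Full._≋_ (f b) part
        fb≃part = proj₂ (surjective part) {b} ≈-refl

        meet : ∀ p → Full._≋_ (f (Small.π p Small.⊓ b)) (Full.π p Full.⊓ part)
        meet p = ≈-trans (∧-homo (Small.π p) b)
          (∧-cong {f (Small.π p)} {Full.π p} {f b} {part} (fixes p) fb≃part)

        -- Each inequality is an equation with a meet. `f` carries it forwards by congruence and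
        -- backwards by injectivity.
        below : ∀ p → Small.class b (proj₁ p) ≡ true ⇔ Full.class part (proj₁ p) ≡ true
        below p = mk⇔
          (λ h → to (Full.π-≤ {p} {part}) (≈-trans (≈-sym (fixes p))
            (≈-trans (⟦⟧-cong {Small.π p} {Small.π p Small.⊓ b} (from (Small.π-≤ {p} {b}) h)) (meet p))))
          (λ h → to (Small.π-≤ {p} {b}) (injective {Small.π p} {Small.π p Small.⊓ b}
            (≈-trans (fixes p) (≈-trans (from (Full.π-≤ {p} {part}) h) (≈-sym (meet p))))))

        -- A condition in the chosen part and outside both codes reveals the tag values of both
        -- classes.
        tags-agree : ∀ e → mem (proj₁ b) (if e then t₀ else t₁) ≡ mem (proj₁ part) (if e then t₀ else t₁)
        tags-agree e =
          let w , nontag , w∈part , w∉ = parts-proper (proj₁ b ∪ proj₁ part) e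
              at-tag : ∀ z → (∀ {v} → v ∊ z → v ∊ (proj₁ b ∪ proj₁ part)) →
                       χ₂ z w ≡ mem z (if e then t₀ else t₁)
              at-tag z z⊆ = trans (χ-outside z nontag (w∉ ∘′ z⊆))
                (cong (λ e → mem z (if e then t₀ else t₁)) w∈part)
              p = w , nontag
          in trans (sym (at-tag (proj₁ b) (∊-∪ˡ _ _)))
               (trans (≡-from-true (to (below p)) (from (below p)))
                 (at-tag (proj₁ part) (∊-∪ʳ _ _)))

theorem1p6 : (∀ ℓ → ExcludedMiddle ℓ) →
    (M : V) → Transitive M → Countable M → ModelOfZF⁻ M →
    DefinableGlobalWellOrder M →
    Σ (ClassForcing M) λ ℙ →
    ∃₂ λ (𝔹₀ 𝔹₁ : BooleanCompletion M ℙ) → ¬ IsomorphismFixing M 𝔹₀ 𝔹₁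
theorem1p6 em M _ _ ZF _ = forcing , Small.completion , Full.completion , no-isomorphism
  where
  open Classical em M
  open Construction ZF
  open ModelOfZF⁻ ZF using (infinity)

  -- Any two distinct elements of `M` can be the tags. Infinity supplies an empty set and a set that
  -- has it as an element.
  ω ∅ : El M
  ω = proj₁ infinity
  ∅ = proj₁ (proj₁ (proj₂ infinity))

  ∅≄ω : ¬ Eq M ∅ ω
  ∅≄ω ∅≃ω = let ∅∊ω , empty = proj₂ (proj₁ (proj₂ infinity)) in
    empty ∅ (∊-resp (≈-sym ∅≃ω) (≈-refl {M ⟨ ∅ ⟩}) ∅∊ω)

  open Algebras ∅ ω ∅≄ω
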